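{- As an identity of formal power series in $q$ with integer coefficients, $$\sum_{n=0}^\infty\big[(q)_\infty-(q)_n\big] =(q)_\infty\sum_{k=1}^\infty\frac{q^k}{1-q^k} +\sum_{r=1}^\infty(-1)^r\Big[(3r-1)q^{r(3r-1)/2}+3r\,q^{r(3r+1)/2}\Big].$$
   Context: For $n$ a nonnegative integer or $n=\infty$, $(a)_n=\prod_{k=1}^n(1-aq^{k-1})$; in particular $(q)_n=\prod_{k=1}^n(1-q^k)$ and $(q)_0=1$. All series are formal power series in $q$ (the sum on the left converges $q$-adically since $(q)_\infty-(q)_n$ is divisible by $q^{n+1}$). -}

module Defs where

open import Data.Bool.Base using (if_then_else_)
open import Data.Fin.Base using (Fin; toℕ; zero; suc)
import Data.Fin.Properties as Fin
open import Data.Integer.Base as ℤ using (ℤ; 0ℤ; 1ℤ; -1ℤ)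
import Data.Integer.Properties as ℤ
open import Data.Nat.Base as ℕ using (ℕ; zero; suc; _≤_; _<_; _∸_; _≡ᵇ_; NonZero; z≤n; s≤s)
open import Data.Nat.DivMod using (_/_; /-monoˡ-≤; m*n/n≡m)
import Data.Nat.Properties as ℕ
open import Data.Product.Base using (∃-syntax; _,_; proj₁; proj₂)
open import Data.Vec.Base using (Vec; []; _∷_; head)
open import Function.Base using (_∘_)
open import Relation.Binary.PropositionalEquality
open import Algebra.Properties.CommutativeMonoid.Sum ℤ.+-0-commutativeMonoid using (sum; sum-syntax; sum-cong-≗)

infix  4 _≈_ _≈_mod-q^_
infixl 6 _+_ _-_
infixl 7 _*_ _·_
infix  9 q^_

-- An element of ℤ[[q]] is its coefficient function.
Series : Set
Series = ℕ → ℤ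

_≈_ : Series → Series → Set
f ≈ g = ∀ n → f n ≡ g n

0ˢ : Series
0ˢ _ = 0ℤ

q^_ : ℕ → Series
(q^ k) n = if k ≡ᵇ n then 1ℤ else 0ℤ

1ˢ q : Series
1ˢ = q^ 0
q  = q^ 1

_+_ _-_ _*_ : Series → Series → Series
(f + g) n = f n ℤ.+ g n
(f - g) n = f n ℤ.- g n
(f * g) n = ∑[ i < suc n ] (f (toℕ i) ℤ.* g (n ∸ toℕ i))

_·_ : ℤ → Series → Series
(c · f) n = c ℤ.* f n

dot : ∀ {n} → Series → Vec ℤ n → ℤ
dot u []      = 0ℤ
dot u (x ∷ v) = u 0 ℤ.* x ℤ.+ dot (u ∘ suc) v

-- The coefficients n, n-1, …, 0 of u⁻¹, obtained by solving u * u⁻¹ = 1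
-- for the top coefficient.
inverseCoeffs : Series → (n : ℕ) → Vec ℤ (suc n)
inverseCoeffs u zero    = 1ℤ ∷ []
inverseCoeffs u (suc n) = ℤ.- dot (u ∘ suc) (inverseCoeffs u n) ∷ inverseCoeffs u n

inverse : (u : Series) → u 0 ≡ 1ℤ → Series
inverse u _ n = head (inverseCoeffs u n)

dot-inverseCoeffs : ∀ u u₀ f n → dot f (inverseCoeffs u n) ≡ (f * inverse u u₀) n
dot-inverseCoeffs u u₀ f zero    = refl
dot-inverseCoeffs u u₀ f (suc n) =
  cong (ℤ._+_ (f 0 ℤ.* inverse u u₀ (suc n))) (dot-inverseCoeffs u u₀ (f ∘ suc) n)

*-inverseʳ : ∀ u u₀ → u * inverse u u₀ ≈ 1ˢ
*-inverseʳ u u₀ zero rewrite u₀ = refl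
*-inverseʳ u u₀ (suc n)
  rewrite sym (dot-inverseCoeffs u u₀ (u ∘ suc) n) | u₀
        | ℤ.*-identityˡ (ℤ.- dot (u ∘ suc) (inverseCoeffs u n))
  = ℤ.+-inverseˡ (dot (u ∘ suc) (inverseCoeffs u n))

-- f - g is divisible by q^N.
_≈_mod-q^_ : Series → Series → ℕ → Set
f ≈ g mod-q^ N = ∀ n → n < N → f n ≡ g n

Convergent : (ℕ → Series) → Set
Convergent s = ∀ N → ∃[ M ] (∀ m → M ≤ m → s m ≈ s M mod-q^ N)

lim : (s : ℕ → Series) → Convergent s → Series
lim s c n = s (proj₁ (c (suc n))) n

_⟶_ : (ℕ → Series) → Series → Set
s ⟶ f = ∀ N → ∃[ M ] (∀ m → M ≤ m → s m ≈ f mod-q^ N)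

lim-correct : ∀ s c → s ⟶ lim s c
lim-correct s c N = proj₁ (c N) , λ m M≤m n n<N →
  let M₁ = proj₁ (c N) ; M₂ = proj₁ (c (suc n)) ; k = M₁ ℕ.⊔ M₂ in
  trans (proj₂ (c N) m M≤m n n<N)
  (trans (sym (proj₂ (c N) k (ℕ.m≤m⊔n M₁ M₂) n n<N))
         (proj₂ (c (suc n)) k (ℕ.m≤n⊔m M₁ M₂) n (ℕ.n<1+n n)))

⟶-unique : ∀ {s f g} → s ⟶ f → s ⟶ g → f ≈ g
⟶-unique a b n =
  let M₁ , p = a (suc n) ; M₂ , r = b (suc n) ; k = M₁ ℕ.⊔ M₂ in
  trans (sym (p k (ℕ.m≤m⊔n M₁ M₂) n (ℕ.n<1+n n))) (r k (ℕ.m≤n⊔m M₁ M₂) n (ℕ.n<1+n n))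

-- partialSum f n adds the terms f 0, …, f (n - 1).
partialSum : (ℕ → Series) → ℕ → Series
partialSum f zero    = 0ˢ
partialSum f (suc n) = partialSum f n + f n

Summable : (ℕ → Series) → Set
Summable f = Convergent (partialSum f)

∑∞ : (f : ℕ → Series) → Summable f → Series
∑∞ f = lim (partialSum f)

steps : ∀ {s : ℕ → Series} → (∀ n → s (suc n) ≈ s n mod-q^ n) → ∀ N d → s (d ℕ.+ N) ≈ s N mod-q^ N
steps h N zero    n n<N = refl
steps {s} h N (suc d) n n<N =
  trans (h (d ℕ.+ N) n (ℕ.<-≤-trans n<N (ℕ.m≤n+m N d))) (steps {s} h N d n n<N)

steps-≤ : ∀ {s : ℕ → Series} → (∀ n → s (suc n) ≈ s n mod-q^ n) → ∀ N m → N ≤ m → s m ≈ s N mod-q^ N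
steps-≤ {s} h N m N≤m n n<N =
  subst (λ k → s k n ≡ s N n) (ℕ.m∸n+n≡m N≤m) (steps {s} h N (m ∸ N) n n<N)

convergent : ∀ {s : ℕ → Series} → (∀ n → s (suc n) ≈ s n mod-q^ n) → Convergent s
convergent {s} h N = N , steps-≤ {s} h N

summable : ∀ {f : ℕ → Series} → (∀ n → f n ≈ 0ˢ mod-q^ n) → Summable f
summable {f} h = convergent {partialSum f} λ n i i<n →
  trans (cong (ℤ._+_ (partialSum f n i)) (h n i i<n)) (ℤ.+-identityʳ _)

*-cong-mod : ∀ {f f′ g g′ : Series} {N} → f ≈ f′ mod-q^ N → g ≈ g′ mod-q^ N → f * g ≈ f′ * g′ mod-q^ N
*-cong-mod a b n n<N = sum-cong-≗ {suc n} λ i → cong₂ ℤ._*_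
  (a (toℕ i) (ℕ.≤-<-trans (Fin.toℕ≤pred[n] i) n<N))
  (b (n ∸ toℕ i) (ℕ.≤-<-trans (ℕ.m∸n≤m n (toℕ i)) n<N))

*-identityʳ : ∀ f → f * 1ˢ ≈ f
*-identityʳ f zero    = trans (ℤ.+-identityʳ _) (ℤ.*-identityʳ (f 0))
*-identityʳ f (suc n) = trans
  (cong₂ ℤ._+_ (ℤ.*-zeroʳ (f 0)) (*-identityʳ (f ∘ suc) n)) (ℤ.+-identityˡ _)

*-zeroˡ : ∀ g → 0ˢ * g ≈ 0ˢ
*-zeroˡ g n = zeros (suc n) (λ i → g (n ∸ toℕ i))
  where
  zeros : ∀ k (t : Fin k → ℤ) → ∑[ i < k ] (0ℤ ℤ.* t i) ≡ 0ℤ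
  zeros zero    t = refl
  zeros (suc k) t = trans (ℤ.+-identityˡ _) (zeros k (t ∘ suc))

*-zeroʳ : ∀ f → f * 0ˢ ≈ 0ˢ
*-zeroʳ f n = zeros (suc n) (λ i → f (toℕ i))
  where
  zeros : ∀ k (t : Fin k → ℤ) → ∑[ i < k ] (t i ℤ.* 0ℤ) ≡ 0ℤ
  zeros zero    t = refl
  zeros (suc k) t = cong₂ ℤ._+_ (ℤ.*-zeroʳ (t zero)) (zeros k (t ∘ suc))

q^-vanishes : ∀ k → q^ k ≈ 0ˢ mod-q^ k
q^-vanishes (suc k) zero    _         = refl
q^-vanishes (suc k) (suc n) (s≤s n<k) = q^-vanishes k n n<k

-- (a)ₙ = ∏_{k=1}^n (1 - a q^{k-1}); the last factor of (a)ₙ₊₁ has k = n + 1.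
poch : Series → ℕ → Series
poch a zero    = 1ˢ
poch a (suc n) = poch a n * (1ˢ - a * q^ n)

poch-step : ∀ a n → poch a (suc n) ≈ poch a n mod-q^ n
poch-step a n i i<n = trans
  (*-cong-mod {poch a n} {poch a n} {1ˢ - a * q^ n} {1ˢ} {n} (λ _ _ → refl) factor i i<n)
  (*-identityʳ (poch a n) i)
  where
  factor : (1ˢ - a * q^ n) ≈ 1ˢ mod-q^ n
  factor j j<n = trans
    (cong (λ x → 1ˢ j ℤ.- x) (trans
      (*-cong-mod {a} {a} {q^ n} {0ˢ} {n} (λ _ _ → refl) (q^-vanishes n) j j<n)
      (*-zeroʳ a j)))
    (ℤ.+-identityʳ _)

poch-convergent : ∀ a → Convergent (poch a)
poch-convergent a = convergent {poch a} (poch-step a)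

poch∞ : Series → Series
poch∞ a = lim (poch a) (poch-convergent a)

pochTail : ℕ → Series
pochTail n = poch∞ q - poch q n

pochTail-summable : Summable pochTail
pochTail-summable = summable {pochTail} λ n i i<n → ℤ.i≡j⇒i-j≡0 (close n i i<n)
  where
  close : ∀ n → poch∞ q ≈ poch q n mod-q^ n
  close n i i<n = sym (steps-≤ {poch q} (poch-step q) (suc i) n i<n i (ℕ.n<1+n i))

1-q^-unit : ∀ k .{{_ : NonZero k}} → (1ˢ - q^ k) 0 ≡ 1ℤ
1-q^-unit (suc k) = refl

lambert : ∀ k .{{_ : NonZero k}} → Series
lambert k = q^ k * inverse (1ˢ - q^ k) (1-q^-unit k)

lambert-summable : Summable (λ j → lambert (suc j))
lambert-summable = summable {λ j → lambert (suc j)} λ j i i<j →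
  let g = inverse (1ˢ - q^ suc j) refl in
  trans (*-cong-mod {q^ suc j} {0ˢ} {g} {g} {suc j} (q^-vanishes (suc j)) (λ _ _ → refl) i (ℕ.m<n⇒m<1+n i<j))
        (*-zeroˡ g i)

-- Both exponents are exact quotients, and ∸ does not truncate for r ≥ 1.
pentagonal : ℕ → Series
pentagonal r = (-1ℤ ℤ.^ r) ·
  ( ℤ.+ (3 ℕ.* r ∸ 1) · q^ (r ℕ.* (3 ℕ.* r ∸ 1) / 2)
  + ℤ.+ (3 ℕ.* r)     · q^ (r ℕ.* (3 ℕ.* r ℕ.+ 1) / 2))

pentagonal-summable : Summable (λ j → pentagonal (suc j))
pentagonal-summable = summable {λ j → pentagonal (suc j)} λ j i i<j →
  let r   = suc j
      i<r = ℕ.m<n⇒m<1+n i<j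
  in zero-coeff (-1ℤ ℤ.^ r) (ℤ.+ (3 ℕ.* r ∸ 1)) (ℤ.+ (3 ℕ.* r))
       (q^-vanishes _ i (ℕ.<-≤-trans i<r (half r (3 ℕ.* r ∸ 1) (two j))))
       (q^-vanishes _ i (ℕ.<-≤-trans i<r (half r (3 ℕ.* r ℕ.+ 1)
         (ℕ.≤-trans (two j) (ℕ.≤-trans (ℕ.m∸n≤m (3 ℕ.* r) 1) (ℕ.m≤m+n _ 1))))))
  where
  half : ∀ r m → 2 ≤ m → r ≤ r ℕ.* m / 2
  half r m 2≤m = subst (_≤ r ℕ.* m / 2) (m*n/n≡m r 2) (/-monoˡ-≤ 2 (ℕ.*-monoʳ-≤ r 2≤m))
  two : ∀ j → 2 ≤ 3 ℕ.* suc j ∸ 1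
  two j = ℕ.∸-monoˡ-≤ {3} {3 ℕ.* suc j} 1 (ℕ.*-monoʳ-≤ 3 {1} {suc j} (s≤s z≤n))
  zero-coeff : ∀ s a b {x y} → x ≡ 0ℤ → y ≡ 0ℤ → s ℤ.* (a ℤ.* x ℤ.+ b ℤ.* y) ≡ 0ℤ
  zero-coeff s a b refl refl rewrite ℤ.*-zeroʳ a | ℤ.*-zeroʳ b = ℤ.*-zeroʳ s

{-# OPTIONS --safe #-}
-- Zagier's argument, truncated and made algebraic.  Summation by parts shows that
--   F_N(x) = ∑_{n<N} (x)ₙ₊₁ xⁿ + (xq)_N x^N
-- satisfies F_{N+1}(x) = 1 - q x² - q² x³ F_N(xq) modulo q^{N+1}.  The sum
--   G_N(x) = 1 + ∑_{r=1}^N (-1)^r (x^{3r-1} q^{r(3r-1)/2} + x^{3r} q^{r(3r+1)/2})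
-- satisfies the same recursion exactly, so F_N ≡ G_N modulo q^N, over any
-- commutative ring.  Now differentiate at x = 1, that is, take x = 1 + ε in the
-- dual numbers: since (x)ₙ₊₁ = -ε (q)ₙ there, the ε-part of F_N is
--   ∑_{n<N} [(q)_N - (q)ₙ] - (q)_N ∑_{k=1}^N q^k / (1 - q^k),
-- and that of G_N is the N-th partial sum of the pentagonal series.
module Submission where

open import Algebra.Bundles using (CommutativeRing; AbelianGroup)
import Algebra.Construct.DirectProduct as DirectProduct
import Algebra.Consequences.Setoid as Consequences
import Algebra.Properties.CommutativeSemiring.Exp as Exp
import Algebra.Properties.Ring as RingProperties
import Algebra.Properties.Semiring.Mult as Mult
import Algebra.Solver.Ring.NaturalCoefficients.Default as Solver
open import Data.Fin.Base using (toℕ)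
open import Data.Integer.Base as ℤ using (ℤ; 0ℤ; -1ℤ)
import Data.Integer.Properties as ℤ
open import Data.Nat.Base as ℕ using (ℕ; zero; suc; _∸_)
open import Data.Nat.DivMod using (_/_; m*n/n≡m)
import Data.Nat.Properties as ℕ
open import Data.Nat.Solver using (module +-*-Solver)
open import Data.Product.Base using (∃-syntax; _,_; proj₁; proj₂)
open import Function.Base using (_∘_)
open import Relation.Binary.Bundles using (Setoid)
open import Relation.Binary.PropositionalEquality as ≡ using (_→-setoid_)
import Relation.Binary.Reasoning.Setoid as SetoidReasoning
open import Algebra.Properties.CommutativeMonoid.Sum ℤ.+-0-commutativeMonoid using (sum-cong-≗; ∑-distrib-+)
open import Algebra.Properties.Semiring.Sum ℤ.+-*-semiring using (*-distribˡ-sum)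

-- pent⁻ j = r(3r-1)/2 and pent⁺ j = r(3r+1)/2 for r = j + 1.
pent⁻ pent⁺ : ℕ → ℕ
pent⁻ zero    = 1
pent⁻ (suc j) = 2 ℕ.+ (2 ℕ.+ j ℕ.* 3 ℕ.+ pent⁻ j)
pent⁺ zero    = 2
pent⁺ (suc j) = 2 ℕ.+ (3 ℕ.+ j ℕ.* 3 ℕ.+ pent⁺ j)

-- Recursions for truncated q-series over a commutative ring.

module QSeries {c ℓ} (R : CommutativeRing c ℓ) (q : CommutativeRing.Carrier R) where

  open CommutativeRing R
  open Exp commutativeSemiring public
  open RingProperties ring
  open Solver commutativeSemiring
  open SetoidReasoning setoid

  sumTo : (ℕ → Carrier) → ℕ → Carrier
  sumTo f zero    = 0#
  sumTo f (suc n) = sumTo f n + f n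

  sumTo-cong : ∀ {f g} → (∀ n → f n ≈ g n) → ∀ N → sumTo f N ≈ sumTo g N
  sumTo-cong h zero    = refl
  sumTo-cong h (suc N) = +-cong (sumTo-cong h N) (h N)

  *-distribˡ-sumTo : ∀ a f N → sumTo (λ n → a * f n) N ≈ a * sumTo f N
  *-distribˡ-sumTo a f zero    = sym (zeroʳ a)
  *-distribˡ-sumTo a f (suc N) =
    trans (+-congʳ (*-distribˡ-sumTo a f N)) (sym (distribˡ a _ _))

  sumTo-head : ∀ f N → sumTo f (suc N) ≈ f 0 + sumTo (f ∘ suc) N
  sumTo-head f zero    = +-comm _ _
  sumTo-head f (suc N) = trans (+-congʳ (sumTo-head f N)) (+-assoc _ _ _)

  x-1*x≈0 : ∀ x → x + - 1# * x ≈ 0#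
  x-1*x≈0 x = trans (+-congˡ (-1*x≈-x x)) (-‿inverseʳ x)

  -- Subtraction takes the form of multiplication by `- 1#` because the solver handles semirings
  -- only, and the single constant `- 1#` can be passed to it as an atom.
  x+y≈z⇒x≈z-1*y : ∀ {x y z} → x + y ≈ z → x ≈ z + - 1# * y
  x+y≈z⇒x≈z-1*y {x} {y} {z} h = begin
    x                    ≈⟨ +-identityʳ x ⟨
    x + 0#               ≈⟨ +-congˡ (x-1*x≈0 y) ⟨
    x + (y + - 1# * y)   ≈⟨ +-assoc x y _ ⟨
    x + y + - 1# * y     ≈⟨ +-congʳ h ⟩
    z + - 1# * y         ∎

  poch : Carrier → ℕ → Carrier
  poch a zero    = 1#
  poch a (suc n) = poch a n * (1# - a * q ^ n)

  -- The definition of `poch` splits off the last factor. Splitting off the first exposes 1 - x,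
  -- which drives the summation by parts and becomes -ε at x = 1 + ε.
  poch-head : ∀ x n → poch x (suc n) ≈ (1# - x) * poch (x * q) n
  poch-head x zero    =
    trans (*-comm _ _) (*-congʳ (+-congˡ (-‿cong (*-identityʳ x))))
  poch-head x (suc n) = begin
    poch x (suc n) * (1# - x * (q * q ^ n))
      ≈⟨ *-cong (poch-head x n) (+-congˡ (-‿cong (sym (*-assoc x q _)))) ⟩
    (1# - x) * poch (x * q) n * (1# - x * q * q ^ n)
      ≈⟨ *-assoc _ _ _ ⟩
    (1# - x) * poch (x * q) (suc n) ∎

  -- S x N truncates Zagier's S(x) = ∑ (x)ₙ₊₁ xⁿ.  The boundary term in F comes
  -- from summation by parts; it is what keeps F meaningful near x = 1, where
  -- S(x) itself diverges.
  S U F : Carrier → ℕ → Carrier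
  S x = sumTo λ n → poch x (suc n) * x ^ n
  U x = sumTo λ n → poch (x * q) n * (x * q) ^ n
  F x N = S x N + poch (x * q) N * x ^ N

  F+x²qU≈1 : ∀ x N → F x N + x * x * q * U x N ≈ 1#
  F+x²qU≈1 x zero = solve 2 (λ x q →
    (con 0 :+ con 1 :* con 1) :+ x :* x :* q :* con 0 := con 1) refl x q
  F+x²qU≈1 x (suc N) = begin
    S x N + poch x (suc N) * y + p * (1# + v) * (x * y) + x * x * q * (U x N + p * (x * q) ^ N)
      ≈⟨ +-cong (+-congʳ (+-congˡ (*-congʳ (poch-head x N))))
                (*-congˡ (+-congˡ (*-congˡ (^-distrib-* x q N)))) ⟩
    S x N + (1# + - x) * p * y + p * (1# + v) * (x * y) + x * x * q * (U x N + p * (y * z))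
      -- The negatives -x and -xqz enter as atoms `u` and `v`. The new terms of `F` and `U` are
      -- grouped so that what they add is a combination of x + u and xqz + v, both zero.
      ≈⟨ solve 9 (λ x q p y z u v s t →
           s :+ (con 1 :+ u) :* p :* y :+ p :* (con 1 :+ v) :* (x :* y) :+ x :* x :* q :* (t :+ p :* (y :* z))
           := (s :+ p :* y :+ x :* x :* q :* t) :+ (p :* y :* (x :+ u) :+ p :* x :* y :* (x :* q :* z :+ v)))
         refl x q p y z (- x) v (S x N) (U x N) ⟩
    F x N + x * x * q * U x N + (p * y * (x + - x) + p * x * y * (x * q * z + v))
      ≈⟨ +-cong (F+x²qU≈1 x N)
                (+-cong (*-congˡ (-‿inverseʳ x)) (*-congˡ (-‿inverseʳ (x * q * z)))) ⟩
    1# + (p * y * 0# + p * x * y * 0#)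
      ≈⟨ solve 2 (λ a b → con 1 :+ (a :* con 0 :+ b :* con 0) := con 1) refl (p * y) (p * x * y) ⟩
    1# ∎
    where
    p = poch (x * q) N
    y = x ^ N
    z = q ^ N
    v = - (x * q * z)

  -- The term n = 0 is 1, and each later term of `U x` is xq times a term of `S (x * q)`.
  U-suc : ∀ x N → U x (suc N) ≈ 1# + x * q * S (x * q) N
  U-suc x zero    = solve 1 (λ w → con 0 :+ con 1 :* con 1 := con 1 :+ w :* con 0) refl (x * q)
  U-suc x (suc N) = begin
    U x (suc N) + p * (x * q * w)                ≈⟨ +-congʳ (U-suc x N) ⟩
    1# + x * q * S (x * q) N + p * (x * q * w)   ≈⟨ solve 4 (λ y s p w →
      con 1 :+ y :* s :+ p :* (y :* w) := con 1 :+ y :* (s :+ p :* w)) refl (x * q) (S (x * q) N) p w ⟩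
    1# + x * q * S (x * q) (suc N) ∎
    where
    p = poch (x * q) (suc N)
    w = (x * q) ^ N

  -- This exact form has `S` where the recursion wants `F`. The boundary term left out contains
  -- (xq)^N, hence q^N, and is moved into the error term of `F≈G`. One factor q of the multiplier is
  -- kept apart, to raise q^N to q^(N+1) there.
  F-suc : ∀ x N → F x (suc N) ≈ 1# + - 1# * (x * x * q) + - 1# * (x * x * x * q) * q * S (x * q) N
  F-suc x N = begin
    F x (suc N)
      ≈⟨ x+y≈z⇒x≈z-1*y (trans (+-congˡ (*-congˡ (sym (U-suc x N)))) (F+x²qU≈1 x (suc N))) ⟩
    1# + - 1# * (x * x * q * (1# + x * q * S (x * q) N))
      ≈⟨ solve 4 (λ n x q s →
           con 1 :+ n :* (x :* x :* q :* (con 1 :+ x :* q :* s))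
           := con 1 :+ n :* (x :* x :* q) :+ n :* (x :* x :* x :* q) :* q :* s)
         refl (- 1#) x q (S (x * q) N) ⟩
    1# + - 1# * (x * x * q) + - 1# * (x * x * x * q) * q * S (x * q) N ∎

  -- The pentagonal sum and its recursion.

  pentTerm : Carrier → ℕ → Carrier
  pentTerm x j = (- 1#) ^ suc j * (x ^ (2 ℕ.+ j ℕ.* 3) * q ^ pent⁻ j + x ^ (3 ℕ.+ j ℕ.* 3) * q ^ pent⁺ j)

  G : Carrier → ℕ → Carrier
  G x N = 1# + sumTo (pentTerm x) N

  -- If x^e q^d is either monomial of `pentTerm x j`, its successor has exponents 3 + e and 2 + (e +
  -- d). This holds by computation, since `pent⁻` and `pent⁺` are defined by exactly this recursion.
  monomial-shift : ∀ x e d → x ^ (3 ℕ.+ e) * q ^ (2 ℕ.+ (e ℕ.+ d)) ≈ x * x * x * q * q * ((x * q) ^ e * q ^ d)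
  monomial-shift x e d = begin
    x * (x * (x * x ^ e)) * (q * (q * q ^ (e ℕ.+ d)))
      ≈⟨ *-congˡ (*-congˡ (*-congˡ (^-homo-* q e d))) ⟩
    x * (x * (x * x ^ e)) * (q * (q * (q ^ e * q ^ d)))
      ≈⟨ solve 5 (λ x q y z w → x :* (x :* (x :* y)) :* (q :* (q :* (z :* w)))
           := x :* x :* x :* q :* q :* (y :* z :* w)) refl x q (x ^ e) (q ^ e) (q ^ d) ⟩
    x * x * x * q * q * (x ^ e * q ^ e * q ^ d)
      ≈⟨ *-congˡ (*-congʳ (^-distrib-* x q e)) ⟨
    x * x * x * q * q * ((x * q) ^ e * q ^ d) ∎

  pentTerm-suc : ∀ x j → pentTerm x (suc j) ≈ - 1# * (x * x * x * q) * q * pentTerm (x * q) j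
  pentTerm-suc x j = trans
    (*-congˡ (+-cong (monomial-shift x (2 ℕ.+ j ℕ.* 3) (pent⁻ j)) (monomial-shift x (3 ℕ.+ j ℕ.* 3) (pent⁺ j))))
    (solve 6 (λ n s c q a b →
       n :* s :* (c :* q :* a :+ c :* q :* b) := n :* c :* q :* (s :* (a :+ b)))
     refl (- 1#) ((- 1#) ^ suc j) (x * x * x * q) q _ _)

  G-suc : ∀ x N → G x (suc N) ≈ 1# + - 1# * (x * x * q) + - 1# * (x * x * x * q) * q * G (x * q) N
  G-suc x N = begin
    1# + sumTo (pentTerm x) (suc N)
      ≈⟨ +-congˡ (sumTo-head (pentTerm x) N) ⟩
    1# + (pentTerm x 0 + sumTo (pentTerm x ∘ suc) N)
      ≈⟨ +-congˡ (+-congˡ (trans (sumTo-cong (pentTerm-suc x) N) (*-distribˡ-sumTo _ _ N))) ⟩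
    1# + (pentTerm x 0 + - 1# * (x * x * x * q) * q * sumTo (pentTerm (x * q)) N)
      -- The term j = 0 is -x²q - x³q²; its second half supplies the summand 1 of `G (x * q) N`.
      ≈⟨ solve 4 (λ n x q s →
           con 1 :+ (n :* con 1 :* (x :* (x :* con 1) :* (q :* con 1) :+ x :* (x :* (x :* con 1)) :* (q :* (q :* con 1)))
             :+ n :* (x :* x :* x :* q) :* q :* s)
           := con 1 :+ n :* (x :* x :* q) :+ n :* (x :* x :* x :* q) :* q :* (con 1 :+ s))
         refl (- 1#) x q (sumTo (pentTerm (x * q)) N) ⟩
    1# + - 1# * (x * x * q) + - 1# * (x * x * x * q) * q * G (x * q) N ∎

  -- Both sides obey the same recursion, and its multiplier -x³q² gains a power of q at each step.
  -- Congruence modulo q^N is expressed by a cofactor `E`, which makes sense in any commutative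
  -- ring.
  F≈G : ∀ x N → ∃[ E ] F x N ≈ G x N + q ^ N * E
  F≈G x zero    = 0# ,
    solve 0 (con 0 :+ con 1 :* con 1 := con 1 :+ con 0 :+ con 1 :* con 0) refl
  F≈G x (suc N) with F≈G (x * q) N
  -- The cofactor combines the inductive one with the boundary term of `F (x * q) N`, whose power
  -- (xq)^N has given up its q^N.
  ... | E , h = m * (E + - 1# * (p * x ^ N)) , (begin
    F x (suc N)
      ≈⟨ F-suc x N ⟩
    d + m * q * S (x * q) N
      ≈⟨ +-congˡ (*-congˡ (x+y≈z⇒x≈z-1*y h)) ⟩
    d + m * q * (G (x * q) N + q ^ N * E + - 1# * (p * (x * q) ^ N))
      ≈⟨ +-congˡ (*-congˡ (+-congˡ (*-congˡ (*-congˡ (^-distrib-* x q N))))) ⟩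
    d + m * q * (G (x * q) N + q ^ N * E + - 1# * (p * (x ^ N * q ^ N)))
      ≈⟨ solve 9 (λ d m q g z e n p y →
           d :+ m :* q :* (g :+ z :* e :+ n :* (p :* (y :* z)))
           := d :+ m :* q :* g :+ q :* z :* (m :* (e :+ n :* (p :* y))))
         refl d m q (G (x * q) N) (q ^ N) E (- 1#) p (x ^ N) ⟩
    d + m * q * G (x * q) N + q * q ^ N * (m * (E + - 1# * (p * x ^ N)))
      ≈⟨ +-congʳ (G-suc x N) ⟨
    G x (suc N) + q ^ suc N * (m * (E + - 1# * (p * x ^ N))) ∎)
    where
    d = 1# + - 1# * (x * x * q)
    m = - 1# * (x * x * x * q)
    p = poch (x * q * q) N

-- The dual numbers R[ε]/(ε²); (a , b) stands for a + b ε.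
module _ {c ℓ} (R : CommutativeRing c ℓ) where

  open CommutativeRing R
  open Solver commutativeSemiring

  private
    additive : AbelianGroup c ℓ
    additive = DirectProduct.abelianGroup +-abelianGroup +-abelianGroup

    module A = AbelianGroup additive

    _⊗_ : A.Carrier → A.Carrier → A.Carrier
    (a , b) ⊗ (c , d) = a * c , a * d + b * c

    ⊗-cong : ∀ {x y u v} → x A.≈ y → u A.≈ v → (x ⊗ u) A.≈ (y ⊗ v)
    ⊗-cong (p , p′) (r , r′) = *-cong p r , +-cong (*-cong p r′) (*-cong p′ r)

    ⊗-comm : ∀ x y → (x ⊗ y) A.≈ (y ⊗ x)
    ⊗-comm (a , b) (c , d) = *-comm a c ,
      solve 4 (λ a b c d → a :* d :+ b :* c := c :* b :+ d :* a) refl a b c d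

    ⊗-assoc : ∀ x y z → ((x ⊗ y) ⊗ z) A.≈ (x ⊗ (y ⊗ z))
    ⊗-assoc (a , b) (c , d) (e , f) = *-assoc a c e ,
      solve 6 (λ a b c d e f → a :* c :* f :+ (a :* d :+ b :* c) :* e
        := a :* (c :* f :+ d :* e) :+ b :* (c :* e)) refl a b c d e f

    ⊗-identityˡ : ∀ x → ((1# , 0#) ⊗ x) A.≈ x
    ⊗-identityˡ (a , b) = *-identityˡ a ,
      solve 2 (λ a b → con 1 :* b :+ con 0 :* a := b) refl a b

    ⊗-distribˡ : ∀ x y z → (x ⊗ (y A.∙ z)) A.≈ ((x ⊗ y) A.∙ (x ⊗ z))
    ⊗-distribˡ (a , b) (c , d) (e , f) = distribˡ a c e ,
      solve 6 (λ a b c d e f → a :* (d :+ f) :+ b :* (c :+ e)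
        := (a :* d :+ b :* c) :+ (a :* f :+ b :* e)) refl a b c d e f

  dual : CommutativeRing c ℓ
  dual = record
    { _≈_ = A._≈_ ; _+_ = A._∙_ ; _*_ = _⊗_ ; -_ = A._⁻¹ ; 0# = A.ε ; 1# = 1# , 0#
    ; isCommutativeRing = record
      { isRing = record
        { +-isAbelianGroup = A.isAbelianGroup
        ; *-cong           = ⊗-cong
        ; *-assoc          = ⊗-assoc
        ; *-identity       = Consequences.comm∧idˡ⇒id A.setoid ⊗-comm ⊗-identityˡ
        ; distrib          = Consequences.comm∧distrˡ⇒distr A.setoid A.∙-cong ⊗-comm ⊗-distribˡ
        }
      ; *-comm = ⊗-comm
      }
    }

-- Differentiation at x = 1.

module TruncatedIdentity {c ℓ} (R : CommutativeRing c ℓ) (q : CommutativeRing.Carrier R) where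

  open CommutativeRing R
  open RingProperties ring
  open Mult semiring using (×-assoc-*; ×-congʳ) renaming (_×_ to _×′_) public
  open Solver commutativeSemiring
  open SetoidReasoning setoid
  open QSeries R q public

  private
    module D = CommutativeRing (dual R)
    module Q = QSeries (dual R) (q , 0#)

    1+ε : D.Carrier
    1+ε = 1# , 1#

  q^-dual : ∀ n → (q , 0#) Q.^ n D.≈ (q ^ n , 0#)
  q^-dual zero    = D.refl
  q^-dual (suc n) = D.trans (D.*-congˡ (q^-dual n)) (refl ,
    solve 2 (λ q z → q :* con 0 :+ con 0 :* z := con 0) refl q (q ^ n))

  [-1]^-dual : ∀ n → D.-_ D.1# Q.^ n D.≈ ((- 1#) ^ n , 0#)
  [-1]^-dual zero    = D.refl
  [-1]^-dual (suc n) = D.trans (D.*-cong (refl , -0#≈0#) ([-1]^-dual n)) (refl ,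
    solve 2 (λ q z → q :* con 0 :+ con 0 :* z := con 0) refl (- 1#) ((- 1#) ^ n))

  [1+ε]^ : ∀ n → 1+ε Q.^ n D.≈ (1# , n ×′ 1#)
  [1+ε]^ zero    = D.refl
  [1+ε]^ (suc n) = D.trans (D.*-congˡ ([1+ε]^ n)) (*-identityˡ 1# ,
    solve 1 (λ m → con 1 :* m :+ con 1 :* con 1 := con 1 :+ m) refl (n ×′ 1#))

  proj₂-sumTo : ∀ f N → proj₂ (Q.sumTo f N) ≈ sumTo (proj₂ ∘ f) N
  proj₂-sumTo f zero    = refl
  proj₂-sumTo f (suc N) = +-congʳ (proj₂-sumTo f N)

  monomial-dual : ∀ m k → 1+ε Q.^ m D.* (q , 0#) Q.^ k D.≈ (q ^ k , m ×′ q ^ k)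
  monomial-dual m k = D.trans (D.*-cong ([1+ε]^ m) (q^-dual k)) (*-identityˡ _ , (begin
    1# * 0# + (m ×′ 1#) * q ^ k   ≈⟨ +-cong (zeroʳ 1#) (×-assoc-* m 1# (q ^ k)) ⟩
    0# + m ×′ (1# * q ^ k)        ≈⟨ +-identityˡ _ ⟩
    m ×′ (1# * q ^ k)             ≈⟨ ×-congʳ m (*-identityˡ _) ⟩
    m ×′ q ^ k                    ∎))

  pentagonal : ℕ → Carrier
  pentagonal j = (- 1#) ^ suc j * ((2 ℕ.+ j ℕ.* 3) ×′ q ^ pent⁻ j + (3 ℕ.+ j ℕ.* 3) ×′ q ^ pent⁺ j)

  pentTerm-dual : ∀ j → proj₂ (Q.pentTerm 1+ε j) ≈ pentagonal j
  pentTerm-dual j = trans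
    (proj₂ (D.*-cong ([-1]^-dual (suc j))
      (D.+-cong (monomial-dual (2 ℕ.+ j ℕ.* 3) (pent⁻ j)) (monomial-dual (3 ℕ.+ j ℕ.* 3) (pent⁺ j)))))
    (trans (+-congˡ (zeroˡ _)) (+-identityʳ _))

  G-dual : ∀ N → proj₂ (Q.G 1+ε N) ≈ sumTo pentagonal N
  G-dual N = trans (+-identityˡ _) (trans (proj₂-sumTo (Q.pentTerm 1+ε) N) (sumTo-cong pentTerm-dual N))

  sumTo-const- : ∀ a f N → sumTo (λ n → a - f n) N ≈ a * (N ×′ 1#) + - 1# * sumTo f N
  sumTo-const- a f zero    = solve 2 (λ a n → con 0 := a :* con 0 :+ n :* con 0) refl a (- 1#)
  sumTo-const- a f (suc N) = trans
    (+-cong (sumTo-const- a f N) (+-congˡ (sym (-1*x≈-x (f N)))))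
    (solve 5 (λ a m n s b → a :* m :+ n :* s :+ (a :+ n :* b) := a :* (con 1 :+ m) :+ n :* (s :+ b))
      refl a (N ×′ 1#) (- 1#) (sumTo f N) (f N))

  -- Over a general ring 1 - q^(k+1) need not be invertible, so `l k` represents q^(k+1) / (1 -
  -- q^(k+1)) through the relation `l-spec`.
  module _ (l : ℕ → Carrier) (l-spec : ∀ k → (1# - q ^ suc k) * l k ≈ q ^ suc k) where

    -- Logarithmic differentiation of (xq)_N at x = 1.
    poch-dual : ∀ N → Q.poch (1+ε D.* (q , 0#)) N D.≈ (poch q N , - 1# * (poch q N * sumTo l N))
    poch-dual zero    = refl , solve 1 (λ n → con 0 := n :* (con 1 :* con 0)) refl (- 1#)
    poch-dual (suc N) = D.trans (D.*-cong (poch-dual N) factor) (refl , (begin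
      p * (- 1# * z) + - 1# * (p * Λ) * (1# - z)
        -- Reading `l-spec` backwards turns the derivative -z of the new factor into -(1 - z) times
        -- `l N`, so that 1 - z can be pulled out of the whole sum.
        ≈⟨ +-congʳ (*-congˡ (*-congˡ (l-spec N))) ⟨
      p * (- 1# * ((1# - z) * l N)) + - 1# * (p * Λ) * (1# - z)
        ≈⟨ solve 5 (λ p n w l s → p :* (n :* (w :* l)) :+ n :* (p :* s) :* w
             := n :* (p :* w :* (s :+ l))) refl p (- 1#) (1# - z) (l N) Λ ⟩
      - 1# * (p * (1# - z) * (Λ + l N)) ∎))
      where
      p = poch q N
      z = q * q ^ N
      Λ = sumTo l N
      factor : D.1# D.- 1+ε D.* (q , 0#) D.* (q , 0#) Q.^ N D.≈ (1# - z , - 1# * z)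
      factor = D.trans (D.+-congˡ (D.-‿cong (D.*-congˡ (q^-dual N))))
        ( +-congˡ (-‿cong (*-congʳ (*-identityˡ q)))
        , (begin
          0# + - (1# * q * 0# + (1# * 0# + 1# * q) * q ^ N)
            ≈⟨ +-identityˡ _ ⟩
          - (1# * q * 0# + (1# * 0# + 1# * q) * q ^ N)
            ≈⟨ -‿cong (solve 2 (λ q y → con 1 :* q :* con 0 :+ (con 1 :* con 0 :+ con 1 :* q) :* y := q :* y) refl q (q ^ N)) ⟩
          - z
            ≈⟨ -1*x≈-x z ⟨
          - 1# * z ∎))

    -- The factor 1 - x of (x)ₙ₊₁ is -ε here, and ε² = 0, so the ε-parts of (xq)ₙ and xⁿ drop out.
    S-dual : ∀ N → proj₂ (Q.S 1+ε N) ≈ - 1# * sumTo (poch q) N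
    S-dual N = trans (proj₂-sumTo _ N) (trans (sumTo-cong term N) (*-distribˡ-sumTo (- 1#) (poch q) N))
      where
      term : ∀ n → proj₂ (Q.poch 1+ε (suc n) D.* 1+ε Q.^ n) ≈ - 1# * poch q n
      term n = trans
        (proj₂ (D.*-cong
          (D.trans (Q.poch-head 1+ε n) (D.*-cong (-‿inverseʳ 1# , +-identityˡ (- 1#)) (poch-dual n)))
          ([1+ε]^ n)))
        (solve 4 (λ n p d m → con 0 :* p :* m :+ (con 0 :* d :+ n :* p) :* con 1 := n :* p)
          refl (- 1#) (poch q n) (- 1# * (poch q n * sumTo l n)) (n ×′ 1#))

    -- By the product rule, the boundary term yields N (q)_N from x^N and the Lambert sum from
    -- (xq)_N. The N copies of (q)_N pair off with the N terms -(q)ₙ coming from `S`.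
    F-dual : ∀ N → proj₂ (Q.F 1+ε N) ≈ sumTo (λ n → poch q N - poch q n) N + - 1# * (poch q N * sumTo l N)
    F-dual N = begin
      proj₂ (Q.F 1+ε N)
        ≈⟨ +-cong (S-dual N) (proj₂ (D.*-cong (poch-dual N) ([1+ε]^ N))) ⟩
      - 1# * sumTo (poch q) N + (poch q N * (N ×′ 1#) + - 1# * (poch q N * sumTo l N) * 1#)
        ≈⟨ solve 3 (λ a b c → a :+ (b :+ c :* con 1) := b :+ a :+ c) refl _ _ _ ⟩
      poch q N * (N ×′ 1#) + - 1# * sumTo (poch q) N + - 1# * (poch q N * sumTo l N)
        ≈⟨ +-congʳ (sumTo-const- (poch q N) (poch q) N) ⟨
      sumTo (λ n → poch q N - poch q n) N + - 1# * (poch q N * sumTo l N) ∎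

    truncated-identity : ∀ N → ∃[ E ]
      sumTo (λ n → poch q N - poch q n) N ≈ poch q N * sumTo l N + sumTo pentagonal N + q ^ N * E
    truncated-identity N with Q.F≈G 1+ε N
    -- Since q has no ε-part, the ε-part of q^N (E₀ + E ε) is q^N E.
    ... | (E₀ , E) , (_ , h) = E , (begin
      Σ                                 ≈⟨ +-identityʳ Σ ⟨
      Σ + 0#                            ≈⟨ +-congˡ (x-1*x≈0 L) ⟨
      Σ + (L + - 1# * L)                ≈⟨ solve 3 (λ a b c → a :+ (b :+ c) := b :+ (a :+ c)) refl Σ L (- 1# * L) ⟩
      L + (Σ + - 1# * L)                ≈⟨ +-congˡ (F-dual N) ⟨
      L + proj₂ (Q.F 1+ε N)             ≈⟨ +-congˡ h ⟩
      L + (proj₂ (Q.G 1+ε N) + (proj₁ Qᴺ * E + proj₂ Qᴺ * E₀))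
        ≈⟨ +-congˡ (+-cong (G-dual N) (proj₂ (D.*-congʳ (q^-dual N)))) ⟩
      L + (sumTo pentagonal N + (q ^ N * E + 0# * E₀))
        ≈⟨ solve 4 (λ a b c d → a :+ (b :+ (c :+ con 0 :* d)) := a :+ b :+ c) refl L (sumTo pentagonal N) (q ^ N * E) E₀ ⟩
      L + sumTo pentagonal N + q ^ N * E ∎)
      where
      Σ  = sumTo (λ n → poch q N - poch q n) N
      L  = poch q N * sumTo l N
      Qᴺ = (q , 0#) Q.^ N

-- The commutative ring of formal power series.

open import Defs

*-distribʳ-+ : ∀ h f g → (f + g) * h ≈ f * h + g * h
*-distribʳ-+ h f g n = ≡.trans
  (sum-cong-≗ {suc n} λ i → ℤ.*-distribʳ-+ (h (n ∸ toℕ i)) (f (toℕ i)) (g (toℕ i)))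
  (∑-distrib-+ {suc n} (λ i → f (toℕ i) ℤ.* h (n ∸ toℕ i)) (λ i → g (toℕ i) ℤ.* h (n ∸ toℕ i)))

·-*-assoc : ∀ a f g → (a · f) * g ≈ a · (f * g)
·-*-assoc a f g n = ≡.trans
  (sum-cong-≗ {suc n} λ i → ℤ.*-assoc a (f (toℕ i)) (g (n ∸ toℕ i)))
  (≡.sym (*-distribˡ-sum {suc n} a λ i → f (toℕ i) ℤ.* g (n ∸ toℕ i)))

*-cong : ∀ {f f′ g g′} → f ≈ f′ → g ≈ g′ → f * g ≈ f′ * g′
*-cong {f} {f′} {g} {g′} a b n =
  *-cong-mod {f} {f′} {g} {g′} (λ i _ → a i) (λ i _ → b i) n (ℕ.n<1+n n)

-- The product unfolds by splitting off the constant term of the left factor. Commutativity also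
-- needs the constant term of the right factor split off.
*-last : ∀ f g n → (f * g) (suc n) ≡.≡ (f * (g ∘ suc)) n ℤ.+ f (suc n) ℤ.* g 0
*-last f g zero    = ≡.cong₂ ℤ._+_ (≡.sym (ℤ.+-identityʳ (f 0 ℤ.* g 1))) (ℤ.+-identityʳ (f 1 ℤ.* g 0))
*-last f g (suc n) = ≡.trans
  (≡.cong (ℤ._+_ (f 0 ℤ.* g (suc (suc n)))) (*-last (f ∘ suc) g n))
  (≡.sym (ℤ.+-assoc (f 0 ℤ.* g (suc (suc n))) (((f ∘ suc) * (g ∘ suc)) n) _))

*-comm : ∀ f g → f * g ≈ g * f
*-comm f g zero    = ≡.cong (ℤ._+ 0ℤ) (ℤ.*-comm (f 0) (g 0))
*-comm f g (suc n) = begin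
  f 0 ℤ.* g (suc n) ℤ.+ ((f ∘ suc) * g) n   ≡⟨ ≡.cong₂ ℤ._+_ (ℤ.*-comm (f 0) (g (suc n))) (*-comm (f ∘ suc) g n) ⟩
  g (suc n) ℤ.* f 0 ℤ.+ (g * (f ∘ suc)) n   ≡⟨ ℤ.+-comm (g (suc n) ℤ.* f 0) _ ⟩
  (g * (f ∘ suc)) n ℤ.+ g (suc n) ℤ.* f 0   ≡⟨ *-last g f n ⟨
  (g * f) (suc n)                           ∎
  where open ≡.≡-Reasoning

-- Induction on the index, for all series at once. The step rests on (f * g) ∘ suc = f 0 · (g ∘ suc)
-- + (f ∘ suc) * g, which holds by computation.
*-assoc : ∀ f g h → (f * g) * h ≈ f * (g * h)
*-assoc f g h zero = begin
  (f 0 ℤ.* g 0 ℤ.+ 0ℤ) ℤ.* h 0 ℤ.+ 0ℤ   ≡⟨ ℤ.+-identityʳ _ ⟩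
  (f 0 ℤ.* g 0 ℤ.+ 0ℤ) ℤ.* h 0           ≡⟨ ≡.cong (ℤ._* h 0) (ℤ.+-identityʳ (f 0 ℤ.* g 0)) ⟩
  f 0 ℤ.* g 0 ℤ.* h 0                    ≡⟨ ℤ.*-assoc (f 0) (g 0) (h 0) ⟩
  f 0 ℤ.* (g 0 ℤ.* h 0)                  ≡⟨ ≡.cong (ℤ._*_ (f 0)) (ℤ.+-identityʳ (g 0 ℤ.* h 0)) ⟨
  f 0 ℤ.* (g 0 ℤ.* h 0 ℤ.+ 0ℤ)           ≡⟨ ℤ.+-identityʳ _ ⟨
  f 0 ℤ.* (g 0 ℤ.* h 0 ℤ.+ 0ℤ) ℤ.+ 0ℤ   ∎
  where open ≡.≡-Reasoning
*-assoc f g h (suc n) = begin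
  (f 0 ℤ.* g 0 ℤ.+ 0ℤ) ℤ.* h (suc n) ℤ.+ ((f 0 · (g ∘ suc) + (f ∘ suc) * g) * h) n
    ≡⟨ ≡.cong₂ ℤ._+_
         (≡.trans (≡.cong (ℤ._* h (suc n)) (ℤ.+-identityʳ (f 0 ℤ.* g 0))) (ℤ.*-assoc (f 0) (g 0) (h (suc n))))
         (≡.trans (*-distribʳ-+ h (f 0 · (g ∘ suc)) ((f ∘ suc) * g) n)
                  (≡.cong₂ ℤ._+_ (·-*-assoc (f 0) (g ∘ suc) h n) (*-assoc (f ∘ suc) g h n))) ⟩
  f 0 ℤ.* (g 0 ℤ.* h (suc n)) ℤ.+ (f 0 ℤ.* ((g ∘ suc) * h) n ℤ.+ ((f ∘ suc) * (g * h)) n)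
    ≡⟨ ℤ.+-assoc (f 0 ℤ.* (g 0 ℤ.* h (suc n))) _ _ ⟨
  f 0 ℤ.* (g 0 ℤ.* h (suc n)) ℤ.+ f 0 ℤ.* ((g ∘ suc) * h) n ℤ.+ ((f ∘ suc) * (g * h)) n
    ≡⟨ ≡.cong (ℤ._+ ((f ∘ suc) * (g * h)) n) (ℤ.*-distribˡ-+ (f 0) (g 0 ℤ.* h (suc n)) (((g ∘ suc) * h) n)) ⟨
  (f * (g * h)) (suc n) ∎
  where open ≡.≡-Reasoning

series-ring : CommutativeRing _ _
series-ring = record
  { Carrier = Series ; _≈_ = _≈_ ; _+_ = _+_ ; _*_ = _*_
  ; -_ = λ f n → ℤ.- f n ; 0# = 0ˢ ; 1# = 1ˢ
  ; isCommutativeRing = record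
    { isRing = record
      { +-isAbelianGroup = record
        { isGroup = record
          { isMonoid = record
            { isSemigroup = record
              { isMagma = record
                { isEquivalence = isEquivalence
                ; ∙-cong = λ a b n → ≡.cong₂ ℤ._+_ (a n) (b n)
                }
              ; assoc = λ f g h n → ℤ.+-assoc (f n) (g n) (h n)
              }
            ; identity = (λ f n → ℤ.+-identityˡ (f n)) , (λ f n → ℤ.+-identityʳ (f n))
            }
          ; inverse = (λ f n → ℤ.+-inverseˡ (f n)) , (λ f n → ℤ.+-inverseʳ (f n))
          ; ⁻¹-cong = λ a n → ≡.cong ℤ.-_ (a n)
          }
        ; comm = λ f g n → ℤ.+-comm (f n) (g n)
        }
      ; *-cong     = λ {f} {f′} {g} {g′} → *-cong {f} {f′} {g} {g′}
      ; *-assoc    = *-assoc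
      ; *-identity = Consequences.comm∧idʳ⇒id setoid {_*_} *-comm *-identityʳ
      ; distrib    = Consequences.comm∧distrʳ⇒distr setoid {_*_} {_+_}
                       (λ a b n → ≡.cong₂ ℤ._+_ (a n) (b n)) *-comm *-distribʳ-+
      }
    ; *-comm = *-comm
    }
  }
  where
  setoid : Setoid _ _
  setoid = ℕ →-setoid ℤ
  open Setoid setoid using (isEquivalence)

-- Ring operations compared with coefficient formulas.

open TruncatedIdentity series-ring q
  using (_^_; _×′_; sumTo; truncated-identity)
  renaming (poch to pochᴿ; pentagonal to pentagonalᴿ)

-- Multiplication by `q` shifts coefficients: `q` has constant term 0, and `q ∘ suc` computes to
-- `1ˢ`.
^≈q^ : ∀ k → q ^ k ≈ q^ k
^≈q^ zero    n       = ≡.refl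
^≈q^ (suc k) zero    = ≡.refl
^≈q^ (suc k) (suc n) = ≡.trans (ℤ.+-identityˡ _)
  (≡.trans (*-comm 1ˢ (q ^ k) n) (≡.trans (*-identityʳ (q ^ k) n) (^≈q^ k n)))

poch≈ : ∀ n → pochᴿ q n ≈ poch q n
poch≈ zero    = λ _ → ≡.refl
poch≈ (suc n) = *-cong {pochᴿ q n} {poch q n} {1ˢ - q * q ^ n} {1ˢ - q * q^ n} (poch≈ n)
  λ i → ≡.cong (ℤ._-_ (1ˢ i)) (*-cong {q} {q} {q ^ n} {q^ n} (λ _ → ≡.refl) (^≈q^ n) i)

×′≈· : ∀ m f → m ×′ f ≈ (ℤ.+ m) · f
×′≈· zero    f n = ≡.refl
×′≈· (suc m) f n = ≡.trans (≡.cong (ℤ._+_ (f n)) (×′≈· m f n)) (≡.sym (ℤ.suc-* (ℤ.+ m) (f n)))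

[-1]^*≈· : ∀ r f → (λ i → ℤ.- 1ˢ i) ^ r * f ≈ (-1ℤ ℤ.^ r) · f
[-1]^*≈· zero    f n = ≡.trans (*-comm 1ˢ f n) (≡.trans (*-identityʳ f n) (≡.sym (ℤ.*-identityˡ (f n))))
[-1]^*≈· (suc r) f n = begin
  ((λ i → ℤ.- 1ˢ i) * s * f) n       ≡⟨ *-assoc (λ i → ℤ.- 1ˢ i) s f n ⟩
  ((λ i → ℤ.- 1ˢ i) * (s * f)) n     ≡⟨ -1*x≈-x (s * f) n ⟩
  ℤ.- (s * f) n                      ≡⟨ ≡.cong ℤ.-_ ([-1]^*≈· r f n) ⟩
  ℤ.- (-1ℤ ℤ.^ r ℤ.* f n)            ≡⟨ ℤ.-1*i≡-i _ ⟨
  -1ℤ ℤ.* (-1ℤ ℤ.^ r ℤ.* f n)        ≡⟨ ℤ.*-assoc -1ℤ (-1ℤ ℤ.^ r) (f n) ⟨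
  -1ℤ ℤ.* -1ℤ ℤ.^ r ℤ.* f n          ∎
  where
  open ≡.≡-Reasoning
  open RingProperties (CommutativeRing.ring series-ring) using (-1*x≈-x)
  s = (λ i → ℤ.- 1ˢ i) ^ r

-- With r = j + 1 the right side is r(3r - 1). The doubled form lets `m*n/n≡m` evaluate the quotient
-- by 2 in `pentagonal`.
pent⁻*2 : ∀ j → pent⁻ j ℕ.* 2 ≡.≡ suc j ℕ.* (2 ℕ.+ j ℕ.* 3)
pent⁻*2 zero    = ≡.refl
pent⁻*2 (suc j) = begin
  (4 ℕ.+ (j ℕ.* 3 ℕ.+ pent⁻ j)) ℕ.* 2
    ≡⟨ solve 2 (λ j p → (con 4 :+ (j :* con 3 :+ p)) :* con 2 := p :* con 2 :+ (con 4 :+ j :* con 3) :* con 2) ≡.refl j (pent⁻ j) ⟩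
  pent⁻ j ℕ.* 2 ℕ.+ (4 ℕ.+ j ℕ.* 3) ℕ.* 2
    ≡⟨ ≡.cong (ℕ._+ (4 ℕ.+ j ℕ.* 3) ℕ.* 2) (pent⁻*2 j) ⟩
  suc j ℕ.* (2 ℕ.+ j ℕ.* 3) ℕ.+ (4 ℕ.+ j ℕ.* 3) ℕ.* 2
    ≡⟨ solve 1 (λ j → (con 1 :+ j) :* (con 2 :+ j :* con 3) :+ (con 4 :+ j :* con 3) :* con 2
                      := (con 2 :+ j) :* (con 5 :+ j :* con 3)) ≡.refl j ⟩
  suc (suc j) ℕ.* (2 ℕ.+ suc j ℕ.* 3) ∎
  where
  open +-*-Solver
  open ≡.≡-Reasoning

pent⁺*2 : ∀ j → pent⁺ j ℕ.* 2 ≡.≡ suc j ℕ.* (4 ℕ.+ j ℕ.* 3)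
pent⁺*2 zero    = ≡.refl
pent⁺*2 (suc j) = begin
  (5 ℕ.+ (j ℕ.* 3 ℕ.+ pent⁺ j)) ℕ.* 2
    ≡⟨ solve 2 (λ j p → (con 5 :+ (j :* con 3 :+ p)) :* con 2 := p :* con 2 :+ (con 5 :+ j :* con 3) :* con 2) ≡.refl j (pent⁺ j) ⟩
  pent⁺ j ℕ.* 2 ℕ.+ (5 ℕ.+ j ℕ.* 3) ℕ.* 2
    ≡⟨ ≡.cong (ℕ._+ (5 ℕ.+ j ℕ.* 3) ℕ.* 2) (pent⁺*2 j) ⟩
  suc j ℕ.* (4 ℕ.+ j ℕ.* 3) ℕ.+ (5 ℕ.+ j ℕ.* 3) ℕ.* 2
    ≡⟨ solve 1 (λ j → (con 1 :+ j) :* (con 4 :+ j :* con 3) :+ (con 5 :+ j :* con 3) :* con 2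
                      := (con 2 :+ j) :* (con 7 :+ j :* con 3)) ≡.refl j ⟩
  suc (suc j) ℕ.* (4 ℕ.+ suc j ℕ.* 3) ∎
  where
  open +-*-Solver
  open ≡.≡-Reasoning

pentagonal≈ : ∀ j → pentagonalᴿ j ≈ pentagonal (suc j)
pentagonal≈ j n = ≡.trans
  ([-1]^*≈· r ((2 ℕ.+ j ℕ.* 3) ×′ q ^ pent⁻ j + (3 ℕ.+ j ℕ.* 3) ×′ q ^ pent⁺ j) n)
  (≡.cong (ℤ._*_ (-1ℤ ℤ.^ r)) (≡.cong₂ ℤ._+_
    (monomial (pent⁻ j) (≡.cong (_∸ 1) r*3≡3*r)
              (≡.trans (pent⁻*2 j) (≡.cong (λ m → r ℕ.* (m ∸ 1)) r*3≡3*r)))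
    (monomial (pent⁺ j) r*3≡3*r
              (≡.trans (pent⁺*2 j) (≡.cong (r ℕ.*_) (≡.trans (ℕ.+-comm 1 (r ℕ.* 3)) (≡.cong (ℕ._+ 1) r*3≡3*r)))))))
  where
  r = suc j
  r*3≡3*r : r ℕ.* 3 ≡.≡ 3 ℕ.* r
  r*3≡3*r = ℕ.*-comm r 3
  monomial : ∀ {m m′} k {e} → m ≡.≡ m′ → k ℕ.* 2 ≡.≡ e → (m ×′ q ^ k) n ≡.≡ ℤ.+ m′ ℤ.* (q^ (e / 2)) n
  monomial {m} k ≡.refl ≡.refl = ≡.trans (×′≈· m (q ^ k) n)
    (≡.cong (ℤ._*_ (ℤ.+ m)) (≡.trans (^≈q^ k n) (≡.cong (λ i → (q^ i) n) (≡.sym (m*n/n≡m k 2)))))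

[1-q^k]*lambert : ∀ k → (1ˢ - q ^ suc k) * lambert (suc k) ≈ q ^ suc k
[1-q^k]*lambert k = begin
  (1ˢ - q ^ suc k) * (q^ suc k * v)   ≈⟨ *-cong {1ˢ - q ^ suc k} {u} {lambert (suc k)} {lambert (suc k)} (λ n → ≡.cong (ℤ._-_ (1ˢ n)) (^≈q^ (suc k) n)) (λ _ → ≡.refl) ⟩
  u * (q^ suc k * v)                  ≈⟨ *-assoc u (q^ suc k) v ⟨
  u * q^ suc k * v                    ≈⟨ *-cong {u * q^ suc k} {q^ suc k * u} {v} {v} (*-comm u (q^ suc k)) (λ _ → ≡.refl) ⟩
  q^ suc k * u * v                    ≈⟨ *-assoc (q^ suc k) u v ⟩
  q^ suc k * (u * v)                  ≈⟨ *-cong {q^ suc k} {q^ suc k} {u * v} {1ˢ} (λ _ → ≡.refl) (*-inverseʳ u ≡.refl) ⟩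
  q^ suc k * 1ˢ                       ≈⟨ *-identityʳ (q^ suc k) ⟩
  q^ suc k                            ≈⟨ ^≈q^ (suc k) ⟨
  q ^ suc k                           ∎
  where
  open SetoidReasoning (ℕ →-setoid ℤ)
  u = 1ˢ - q^ suc k
  v = inverse u ≡.refl

-- Passage to the limit.

sumTo≈partialSum : ∀ {f g n} → (∀ k → f k n ≡.≡ g k n) → ∀ N → sumTo f N n ≡.≡ partialSum g N n
sumTo≈partialSum h zero    = ≡.refl
sumTo≈partialSum h (suc N) = ≡.cong₂ ℤ._+_ (sumTo≈partialSum h N) (h N)

q^*-vanishes : ∀ N E → q ^ N * E ≈ 0ˢ mod-q^ N
q^*-vanishes N E n n<N = ≡.trans
  (*-cong-mod {q ^ N} {0ˢ} {E} {E} (λ i i<N → ≡.trans (^≈q^ N i) (q^-vanishes N i i<N)) (λ _ _ → ≡.refl) n n<N)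
  (*-zeroˡ E n)

lim-stable : ∀ {s : ℕ → Series} (h : ∀ n → s (suc n) ≈ s n mod-q^ n) N →
             lim s (convergent {s} h) ≈ s N mod-q^ N
lim-stable {s} h N n n<N = ≡.sym (steps-≤ {s} h (suc n) N n<N n (ℕ.n<1+n n))

theorem1 : ∑∞ (λ n → poch∞ q - poch q n) pochTail-summable
    ≈ poch∞ q * ∑∞ (λ j → let k = suc j in q^ k * inverse (1ˢ - q^ k) (1-q^-unit k)) lambert-summable
    + ∑∞ (λ j → let r = suc j in (-1ℤ ℤ.^ r) · (ℤ.+ (3 ℕ.* r ∸ 1) · q^ (r ℕ.* (3 ℕ.* r ∸ 1) / 2) + ℤ.+ (3 ℕ.* r) · q^ (r ℕ.* (3 ℕ.* r ℕ.+ 1) / 2))) pentagonal-summable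
theorem1 n = begin
  -- The limits are built so that their coefficient at `n` computes to that of the approximant of
  -- index `suc n`. Hence `poch∞ q` and `poch q N` agree at `n` by computation, and so does each
  -- infinite sum with its partial sum of length `N`.
  partialSum (λ k → poch∞ q - poch q k) N n
    ≡⟨ sumTo≈partialSum {n = n} (λ k → ≡.cong₂ ℤ._-_ (poch≈ N n) (poch≈ k n)) N ⟨
  sumTo (λ k → pochᴿ q N - pochᴿ q k) N n
    ≡⟨ proj₂ truncated n ⟩
  (pochᴿ q N * sumTo (λ j → lambert (suc j)) N) n ℤ.+ sumTo pentagonalᴿ N n ℤ.+ (q ^ N * E) n
    ≡⟨ ≡.cong₂ ℤ._+_ (≡.cong₂ ℤ._+_ product (sumTo≈partialSum {n = n} (λ j → pentagonal≈ j n) N))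
                     (q^*-vanishes N E n (ℕ.n<1+n n)) ⟩
  (poch∞ q * ∑∞ (λ j → lambert (suc j)) lambert-summable) n ℤ.+ partialSum (λ j → pentagonal (suc j)) N n ℤ.+ 0ℤ
    ≡⟨ ℤ.+-identityʳ _ ⟩
  (poch∞ q * ∑∞ (λ j → lambert (suc j)) lambert-summable) n ℤ.+ partialSum (λ j → pentagonal (suc j)) N n ∎
  where
  open ≡.≡-Reasoning
  N = suc n
  truncated = truncated-identity (λ j → lambert (suc j)) [1-q^k]*lambert N
  E = proj₁ truncated
  product : (pochᴿ q N * sumTo (λ j → lambert (suc j)) N) n
            ≡.≡ (poch∞ q * ∑∞ (λ j → lambert (suc j)) lambert-summable) n
  -- The product involves every coefficient i ≤ n, where the limits compute to approximants of index
  -- `suc i` rather than `N`. The convergence estimates bridge the difference.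
  product = *-cong-mod {pochᴿ q N} {poch∞ q} {sumTo (λ j → lambert (suc j)) N} {∑∞ (λ j → lambert (suc j)) lambert-summable}
    (λ i i<N → ≡.trans (poch≈ N i) (≡.sym (lim-stable {poch q} (poch-step q) N i i<N)))
    (λ i i<N → ≡.trans (sumTo≈partialSum {n = i} (λ _ → ≡.refl) N)
      (proj₂ (lambert-summable (suc i)) N i<N i (ℕ.n<1+n i)))
    n (ℕ.n<1+n n)
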